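{- Let $\rho$ be a positive integer and $v$ an integer with $v \ge 9\rho + 31$. Then \[ \beta(\rho,v,4) \le \frac{\rho v}{3} + 5\rho^2 - \frac{16\rho}{3}. \]
   Context: For integers $v \ge k \ge 2$, a $(v,k)$-packing is a pair $(X,\mathcal{B})$ where $X$ is a set of $v$ points and $\mathcal{B}$ is a set of $k$-subsets of $X$ (blocks) such that every pair of distinct points lies in at most one block. A partial parallel class (PPC) is a set of pairwise disjoint blocks; its size is the number of blocks. A PPC of size $\rho$ is maximum if the packing has no PPC of size $\rho+1$. $\beta(\rho,v,k)$ denotes the maximum number of blocks in a $(v,k)$-packing in which the maximum PPC has size $\rho$. -}

module Defs where

open import Data.Bool.Base using (Bool; true; false)
open import Data.Bool.Properties as Bool using ()
open import Data.Fin.Base using (Fin; zero; suc; combine)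
open import Data.Fin.Properties as Fin using (all?; combine-injective; injective⇒≤)
open import Data.Fin.Subset using (Subset; _∈_; _∩_; ∣_∣; Empty)
open import Data.Fin.Subset.Properties using (_∈?_; nonempty?; anySubset?)
open import Data.Nat.Base using (ℕ; zero; suc; _≤_; _^_; z≤n; s≤s)
open import Data.Nat.Properties using (_≟_; m≤n⇒m<n∨m≡n)
open import Data.Product.Base using (Σ; ∃; ∃-syntax; _×_; _,_)
open import Data.Sum.Base using (inj₁; inj₂)
open import Data.Vec.Base using (Vec; []; _∷_; lookup)
open import Data.Vec.Properties using (≡-dec)
open import Function.Base using (_∘_)
open import Relation.Binary.PropositionalEquality using (_≡_; _≢_; refl; cong₂)
open import Relation.Nullary.Decidable using (Dec; yes; no; map′; ¬?; _×-dec_; _→-dec_)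
open import Relation.Nullary.Negation using (¬_; contradiction)
open import Relation.Unary using (Decidable)

private variable
  v b : ℕ

-- The point set is Fin v.  A set of b blocks is given by a repetition-free
-- enumeration ℬ of its members, so that b is the number of blocks.

record IsPacking (k : ℕ) (ℬ : Vec (Subset v) b) : Set where
  field
    distinct   : ∀ i j → lookup ℬ i ≡ lookup ℬ j → i ≡ j
    block-size : ∀ i → ∣ lookup ℬ i ∣ ≡ k
    pair-≤1    : ∀ x y → x ≢ y →
                 ∀ i → x ∈ lookup ℬ i → y ∈ lookup ℬ i →
                 ∀ j → x ∈ lookup ℬ j → y ∈ lookup ℬ j →
                 i ≡ j

-- A subset of the blocks is a subset of the indices of the enumeration.

IsPPC : Vec (Subset v) b → Subset b → Set
IsPPC ℬ S = ∀ i j → i ∈ S → j ∈ S → i ≢ j → Empty (lookup ℬ i ∩ lookup ℬ j)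

HasPPC : Vec (Subset v) b → ℕ → Set
HasPPC ℬ ρ = ∃[ S ] IsPPC ℬ S × ∣ S ∣ ≡ ρ

MaxPPC : Vec (Subset v) b → ℕ → Set
MaxPPC ℬ ρ = HasPPC ℬ ρ × ¬ HasPPC ℬ (suc ρ)

Attained : (ρ v k b : ℕ) → Set
Attained ρ v k b = Σ (Vec (Subset v) b) λ ℬ → IsPacking k ℬ × MaxPPC ℬ ρ

isPacking? : ∀ k (ℬ : Vec (Subset v) b) → Dec (IsPacking k ℬ)
isPacking? k ℬ =
  map′ (λ (d , s , p) → record { distinct = d ; block-size = s ; pair-≤1 = p })
       (λ P → let open IsPacking P in distinct , block-size , pair-≤1)
       ( all? (λ i → all? λ j →
           ≡-dec Bool._≟_ (lookup ℬ i) (lookup ℬ j) →-dec (i Fin.≟ j))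
       ×-dec all? (λ i → ∣ lookup ℬ i ∣ ≟ k)
       ×-dec all? (λ x → all? λ y → ¬? (x Fin.≟ y) →-dec
           all? λ i → (x ∈? lookup ℬ i) →-dec ((y ∈? lookup ℬ i) →-dec
           all? λ j → (x ∈? lookup ℬ j) →-dec ((y ∈? lookup ℬ j) →-dec
           (i Fin.≟ j)))))

isPPC? : (ℬ : Vec (Subset v) b) → Decidable (IsPPC ℬ)
isPPC? ℬ S = all? λ i → all? λ j →
  (i ∈? S) →-dec ((j ∈? S) →-dec (¬? (i Fin.≟ j) →-dec
  ¬? (nonempty? (lookup ℬ i ∩ lookup ℬ j))))

hasPPC? : (ℬ : Vec (Subset v) b) → Decidable (HasPPC ℬ)
hasPPC? ℬ ρ = anySubset? λ S → isPPC? ℬ S ×-dec (∣ S ∣ ≟ ρ)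

maxPPC? : (ℬ : Vec (Subset v) b) → Decidable (MaxPPC ℬ)
maxPPC? ℬ ρ = hasPPC? ℬ ρ ×-dec ¬? (hasPPC? ℬ (suc ρ))

anyFamily? : ∀ b {P : Vec (Subset v) b → Set} → Decidable P → Dec (∃ P)
anyFamily? zero    P? = map′ ([] ,_) (λ { ([] , p) → p }) (P? [])
anyFamily? (suc b) P? =
  map′ (λ (B , ℬ , p) → B ∷ ℬ , p) (λ { (B ∷ ℬ , p) → B , ℬ , p })
       (anySubset? λ B → anyFamily? b (P? ∘ (B ∷_)))

attained? : ∀ ρ v k → Decidable (Attained ρ v k)
attained? ρ v k b = anyFamily? b λ ℬ → isPacking? k ℬ ×-dec maxPPC? ℬ ρ

-- The greatest m ≤ n satisfying P, or 0 if there is none.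

greatest : {P : ℕ → Set} → Decidable P → ℕ → ℕ
greatest P? zero = zero
greatest P? (suc n) with P? (suc n)
... | yes _ = suc n
... | no  _ = greatest P? n

-- The cut-off 2 ^ v, the number of all subsets of the point set, loses
-- nothing: see β-attained and β-upper below.

β : (ρ v k : ℕ) → ℕ
β ρ v k = greatest (attained? ρ v k) (2 ^ v)

private
  greatest-upper : {P : ℕ → Set} (P? : Decidable P) →
                   ∀ {m} n → m ≤ n → P m → m ≤ greatest P? n
  greatest-upper P? zero    m≤n Pm = m≤n
  greatest-upper P? (suc n) m≤n Pm with P? (suc n)
  ... | yes _ = m≤n
  ... | no ¬P with m≤n⇒m<n∨m≡n m≤n
  ...   | inj₁ (s≤s m≤n′) = greatest-upper P? n m≤n′ Pm
  ...   | inj₂ refl       = contradiction Pm ¬P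

  greatest-holds : {P : ℕ → Set} (P? : Decidable P) →
                   ∀ {m} n → m ≤ n → P m → P (greatest P? n)
  greatest-holds P? zero    z≤n Pm = Pm
  greatest-holds P? (suc n) m≤n Pm with P? (suc n)
  ... | yes P = P
  ... | no ¬P with m≤n⇒m<n∨m≡n m≤n
  ...   | inj₁ (s≤s m≤n′) = greatest-holds P? n m≤n′ Pm
  ...   | inj₂ refl       = contradiction Pm ¬P

  bit : Bool → Fin 2
  bit false = zero
  bit true  = suc zero

  bit-injective : ∀ x y → bit x ≡ bit y → x ≡ y
  bit-injective false false _ = refl
  bit-injective true  true  _ = refl

  code : Subset v → Fin (2 ^ v)
  code []      = zero
  code (x ∷ p) = combine (bit x) (code p)

  code-injective : (p q : Subset v) → code p ≡ code q → p ≡ q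
  code-injective []      []      _  = refl
  code-injective (x ∷ p) (y ∷ q) eq
    with eq₁ , eq₂ ← combine-injective (bit x) (code p) (bit y) (code q) eq
    = cong₂ _∷_ (bit-injective x y eq₁) (code-injective p q eq₂)

  attained-≤ : ∀ {ρ v k b} → Attained ρ v k b → b ≤ 2 ^ v
  attained-≤ (ℬ , P , _) = injective⇒≤ {f = code ∘ lookup ℬ}
    λ {i} {j} eq → IsPacking.distinct P i j (code-injective _ _ eq)

β-attained : ∀ {ρ v k b} → Attained ρ v k b → Attained ρ v k (β ρ v k)
β-attained {ρ} {v} {k} A = greatest-holds (attained? ρ v k) (2 ^ v) (attained-≤ A) A

β-upper : ∀ {ρ v k b} → Attained ρ v k b → b ≤ β ρ v k
β-upper {ρ} {v} {k} A = greatest-upper (attained? ρ v k) (2 ^ v) (attained-≤ A) A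

{-# OPTIONS --safe #-}
module Submission where

-- Fix a maximum partial parallel class S.  For p in S, the blocks disjoint
-- from all other members of S pairwise intersect, so either they share a point
-- x of p (p is a star, and at most (v - 1)/3 blocks contain x), or there are at
-- most 13 of them (p is spread).  Any block that contains no centre of a star
-- and is not one of these at most 13 blocks for some spread p meets two
-- different members of S outside the centres, and two points lie in at most one
-- block.  With s stars and t spread members, counting ordered pairs gives
-- 6b <= 2s(v - 1) + 78t + 3((3s + 4t)² - 9s - 16t), which for ρ = s + t and
-- v = 9ρ + 31 + w falls short of 2ρv + 30ρ² - 32ρ by 3s(s - 1) + 6st + 2tw >= 0.

open import Defs
open import Data.Bool.Base using (if_then_else_; true; false)
open import Data.Fin.Base using (Fin; zero; suc)
open import Data.Fin.Properties as Fin using (any?)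
open import Data.Fin.Subset
  using (Subset; Nonempty; Empty; inside; outside; _∈_; _∉_; _∩_; ∁; ⊥; ⁅_⁆; ∣_∣)
  renaming (_-_ to _∖_)
open import Data.Fin.Subset.Properties
  using (_∈?_; nonempty?; ∉⊥; ∣⊥∣≡0; ∣⁅x⁆∣≡1; ∣∁p∣≡n∸∣p∣; x∈p⇒x∉∁p; x∉p⇒x∈∁p; x∈⁅x⁆;
    x∈⁅y⁆⇒x≡y; x∈p∩q⁺; x∈p∩q⁻; p─q⊆p; x∈p∧x≢y⇒x∈p-y; x∈p⇒∣p-x∣<∣p∣)
open import Data.Integer.Base as ℤ using (+_; +≤+)
open import Data.Integer.Properties as ℤ using ()
open import Data.Nat.Base as ℕ using (ℕ; zero; suc; _*_; _∸_; _^_; z≤n; s≤s)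
open import Data.Nat.Properties as ℕ using ()
open import Data.Nat.Tactic.RingSolver using (solve-∀)
open import Data.Product.Base using (∃-syntax; _×_; _,_)
open import Data.Rational.Base as ℚ using (ℚ; 0ℚ; _/_; _+_; _-_; _≤_)
open import Data.Rational.Properties as ℚ using ()
open import Data.Rational.Unnormalised.Base as ℚᵘ using (mkℚᵘ; *≤*)
open import Data.Rational.Unnormalised.Properties as ℚᵘ using ()
open import Data.Sum.Base using (_⊎_; inj₁; inj₂)
open import Data.Vec.Base using (Vec; []; _∷_; here; there; lookup; _[_]≔_)
open import Data.Vec.Properties
  using (lookup⇒[]=; []=⇒lookup; lookup∘updateAt; lookup∘updateAt′)
open import Function.Base using (_∘_)
open import Relation.Binary.PropositionalEquality
  using (_≡_; _≢_; refl; sym; trans; cong; cong₂; subst; subst₂; module ≡-Reasoning)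
open import Relation.Nullary.Decidable
  using (Dec; yes; no; does; ¬?; _×-dec_; decidable-stable)
open import Relation.Nullary.Negation using (¬_; contradiction)
open import Relation.Unary using (Decidable)

open import Algebra.Properties.Semiring.Sum ℕ.+-*-semiring
  using (sum; sum-syntax; sum-cong-≗; ∑-distrib-+; ∑-comm; *-distribˡ-sum;
    *-distribʳ-sum)

private variable
  m n : ℕ
  A : Set

-- Finite sums of natural numbers

sum-mono : {f g : Fin n → ℕ} → (∀ i → f i ℕ.≤ g i) → sum f ℕ.≤ sum g
sum-mono {zero}  f≤g = z≤n
sum-mono {suc n} f≤g = ℕ.+-mono-≤ (f≤g zero) (sum-mono (f≤g ∘ suc))

sum-const : ∀ n c → ∑[ i < n ] c ≡ n * c
sum-const zero    c = refl
sum-const (suc n) c = cong (c ℕ.+_) (sum-const n c)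

term≤sum : (f : Fin n → ℕ) → ∀ i → f i ℕ.≤ sum f
term≤sum f zero    = ℕ.m≤m+n _ _
term≤sum f (suc i) = ℕ.≤-trans (term≤sum (f ∘ suc) i) (ℕ.m≤n+m _ _)

two-terms≤sum : (f : Fin n → ℕ) → ∀ {i j} → i ≢ j → f i ℕ.+ f j ℕ.≤ sum f
two-terms≤sum f {zero}  {zero}  i≢j = contradiction refl i≢j
two-terms≤sum f {zero}  {suc j} i≢j = ℕ.+-monoʳ-≤ (f zero) (term≤sum (f ∘ suc) j)
two-terms≤sum f {suc i} {zero}  i≢j =
  ℕ.≤-trans (ℕ.≤-reflexive (ℕ.+-comm (f (suc i)) (f zero)))
            (ℕ.+-monoʳ-≤ (f zero) (term≤sum (f ∘ suc) i))
two-terms≤sum f {suc i} {suc j} i≢j =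
  ℕ.≤-trans (two-terms≤sum (f ∘ suc) (i≢j ∘ cong suc)) (ℕ.m≤n+m _ _)

-- Double counting in the form used below: with `a` the indicator of a point set and `g` the
-- incidence of points and blocks, a sum over blocks becomes a sum over the points of that set.
weighted-∑-comm : (a : Fin m → ℕ) (g : Fin m → Fin n → ℕ) (h : Fin n → ℕ) →
  ∑[ i < n ] ((∑[ x < m ] (a x * g x i)) * h i) ≡ ∑[ x < m ] (a x * ∑[ i < n ] (g x i * h i))
weighted-∑-comm {m} {n} a g h = begin
  ∑[ i < n ] ((∑[ x < m ] (a x * g x i)) * h i)
    ≡⟨ sum-cong-≗ (λ i → *-distribʳ-sum (h i) (λ x → a x * g x i)) ⟩
  ∑[ i < n ] ∑[ x < m ] (a x * g x i * h i)
    ≡⟨ ∑-comm (λ i x → a x * g x i * h i) ⟩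
  ∑[ x < m ] ∑[ i < n ] (a x * g x i * h i)
    ≡⟨ sum-cong-≗ (λ x → sum-cong-≗ λ i → ℕ.*-assoc (a x) (g x i) (h i)) ⟩
  ∑[ x < m ] ∑[ i < n ] (a x * (g x i * h i))
    ≡⟨ sum-cong-≗ (λ x → sym (*-distribˡ-sum (a x) (λ i → g x i * h i))) ⟩
  ∑[ x < m ] (a x * ∑[ i < n ] (g x i * h i)) ∎
  where open ≡-Reasoning

-- Iverson brackets of decidable propositions

⟦_⟧ : Dec A → ℕ
⟦ d ⟧ = if does d then 1 else 0

⟦⟧-yes : (d : Dec A) → A → ⟦ d ⟧ ≡ 1
⟦⟧-yes (yes _) a = refl
⟦⟧-yes (no ¬a) a = contradiction a ¬a

⟦⟧-no : (d : Dec A) → ¬ A → ⟦ d ⟧ ≡ 0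
⟦⟧-no (yes a) ¬a = contradiction a ¬a
⟦⟧-no (no _)  ¬a = refl

⟦⟧-× : {B : Set} (d : Dec A) (e : Dec B) → ⟦ d ×-dec e ⟧ ≡ ⟦ d ⟧ * ⟦ e ⟧
⟦⟧-× (yes _) (yes _) = refl
⟦⟧-× (yes _) (no _)  = refl
⟦⟧-× (no _)  e       = refl

⟦⟧-idem : (d : Dec A) → ⟦ d ⟧ * ⟦ d ⟧ ≡ ⟦ d ⟧
⟦⟧-idem (yes _) = refl
⟦⟧-idem (no _)  = refl

⟦⟧*-mono : (d : Dec A) → (A → m ℕ.≤ n) → ⟦ d ⟧ * m ℕ.≤ ⟦ d ⟧ * n
⟦⟧*-mono (yes a) m≤n = ℕ.*-monoʳ-≤ 1 (m≤n a)
⟦⟧*-mono (no _)  m≤n = z≤n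

⟦⟧-unique : {P : Fin n → Set} (P? : Decidable P) →
            (∀ i j → P i → P j → i ≡ j) → ∑[ i < n ] ⟦ P? i ⟧ ℕ.≤ 1
⟦⟧-unique {zero}  P? unique = z≤n
⟦⟧-unique {suc n} P? unique with P? zero
... | no _  = ⟦⟧-unique (P? ∘ suc) λ i j Pi Pj → Fin.suc-injective (unique _ _ Pi Pj)
... | yes P₀ = ℕ.≤-reflexive (cong suc (trans (sum-cong-≗ none) (trans (sum-const n 0) (ℕ.*-zeroʳ n))))
  where
  none : ∀ i → ⟦ P? (suc i) ⟧ ≡ 0
  none i = ⟦⟧-no (P? (suc i)) λ Pi → Fin.0≢1+n (unique _ _ P₀ Pi)

∑-⟦≟⟧ : (j : Fin n) → ∑[ i < n ] ⟦ i Fin.≟ j ⟧ ≡ 1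
∑-⟦≟⟧ {n} j = ℕ.≤-antisym
  (⟦⟧-unique (Fin._≟ j) λ i i′ p q → trans p (sym q))
  (subst (ℕ._≤ ∑[ i < n ] ⟦ i Fin.≟ j ⟧) (⟦⟧-yes (j Fin.≟ j) refl) (term≤sum (λ i → ⟦ i Fin.≟ j ⟧) j))

-- Cardinalities of subsets

∣p∣≡∑ : (p : Subset n) → ∣ p ∣ ≡ ∑[ x < n ] ⟦ x ∈? p ⟧
∣p∣≡∑ []            = refl
∣p∣≡∑ (true  ∷ p) = cong suc (∣p∣≡∑ p)
∣p∣≡∑ (false ∷ p) = ∣p∣≡∑ p

∣p[x]≔inside∣ : (p : Subset n) {x : Fin n} → x ∉ p → ∣ p [ x ]≔ inside ∣ ≡ suc ∣ p ∣
∣p[x]≔inside∣ (true  ∷ p) {zero}  x∉p = contradiction here x∉p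
∣p[x]≔inside∣ (false ∷ p) {zero}  x∉p = refl
∣p[x]≔inside∣ (true  ∷ p) {suc x} x∉p = cong suc (∣p[x]≔inside∣ p (x∉p ∘ there))
∣p[x]≔inside∣ (false ∷ p) {suc x} x∉p = ∣p[x]≔inside∣ p (x∉p ∘ there)

∣p[x]≔outside∣ : (p : Subset n) {x : Fin n} → x ∈ p → suc ∣ p [ x ]≔ outside ∣ ≡ ∣ p ∣
∣p[x]≔outside∣ (true  ∷ p) {zero}  x∈p         = refl
∣p[x]≔outside∣ (true  ∷ p) {suc x} (there x∈p) = cong suc (∣p[x]≔outside∣ p x∈p)
∣p[x]≔outside∣ (false ∷ p) {suc x} (there x∈p) = ∣p[x]≔outside∣ p x∈p

∈-[]≔-≢ : (p : Subset n) {x y : Fin n} {s : _} → y ≢ x → y ∈ p [ x ]≔ s → y ∈ p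
∈-[]≔-≢ p y≢x y∈ =
  lookup⇒[]= _ p (trans (sym (lookup∘updateAt′ _ _ y≢x p)) ([]=⇒lookup y∈))

∈-[]≔outside : (p : Subset n) {x y : Fin n} → y ∈ p [ x ]≔ outside → y ≢ x × y ∈ p
∈-[]≔outside p {x} y∈ = y≢x , ∈-[]≔-≢ p y≢x y∈
  where
  y≢x : _ ≢ x
  y≢x refl with trans (sym (lookup∘updateAt x p)) ([]=⇒lookup y∈)
  ... | ()

∈-[]≔inside : (p : Subset n) {x y : Fin n} → y ∈ p [ x ]≔ inside → y ≡ x ⊎ y ∈ p
∈-[]≔inside p {x} {y} y∈ with y Fin.≟ x
... | yes y≡x = inj₁ y≡x
... | no  y≢x = inj₂ (∈-[]≔-≢ p y≢x y∈)

∣p∣>0⇒Nonempty : (p : Subset n) → 1 ℕ.≤ ∣ p ∣ → Nonempty p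
∣p∣>0⇒Nonempty (true  ∷ p) _ = zero , here
∣p∣>0⇒Nonempty (false ∷ p) 1≤∣p∣ with x , x∈p ← ∣p∣>0⇒Nonempty p 1≤∣p∣ = suc x , there x∈p

-- Incidence counting in a packing

module Incidence {v b k : ℕ} {ℬ : Vec (Subset v) b} (packing : IsPacking k ℬ) where
  open IsPacking packing

  inc : Fin v → Fin b → ℕ
  inc x i = ⟦ x ∈? lookup ℬ i ⟧

  -- The size of the intersection of `C` with block `i`, kept as a sum of products so that
  -- `weighted-∑-comm` applies.
  meet : Subset v → Fin b → ℕ
  meet C i = ∑[ x < v ] (⟦ x ∈? C ⟧ * inc x i)

  meet-positive : ∀ {C i x} → x ∈ C → x ∈ lookup ℬ i → 1 ℕ.≤ meet C i
  meet-positive {C} {i} {x} x∈C x∈i =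
    subst (ℕ._≤ meet C i) (cong₂ _*_ (⟦⟧-yes (x ∈? C) x∈C) (⟦⟧-yes (x ∈? lookup ℬ i) x∈i))
          (term≤sum (λ x → ⟦ x ∈? C ⟧ * inc x i) x)

  ∑-inc : ∀ i → ∑[ x < v ] inc x i ≡ k
  ∑-inc i = trans (sym (∣p∣≡∑ (lookup ℬ i))) (block-size i)

  meet-self : ∀ i → meet (lookup ℬ i) i ≡ k
  meet-self i = trans (sum-cong-≗ λ x → ⟦⟧-idem (x ∈? lookup ℬ i)) (∑-inc i)

  -- Each `y` in `C` differs from `x`, so at most one block contains both; the sum counts such
  -- points `y` together with a block through `y` and `x`.
  ∑-meet*inc≤∣C∣ : ∀ {x} C → x ∉ C → ∑[ i < b ] (meet C i * inc x i) ℕ.≤ ∣ C ∣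
  ∑-meet*inc≤∣C∣ {x} C x∉C = begin
    ∑[ i < b ] (meet C i * inc x i)
      ≡⟨ weighted-∑-comm (λ y → ⟦ y ∈? C ⟧) inc (inc x) ⟩
    ∑[ y < v ] (⟦ y ∈? C ⟧ * ∑[ i < b ] (inc y i * inc x i))
      ≤⟨ sum-mono (λ y → ⟦⟧*-mono (y ∈? C) (common≤1 y)) ⟩
    ∑[ y < v ] (⟦ y ∈? C ⟧ * 1)
      ≡⟨ sum-cong-≗ (λ y → ℕ.*-identityʳ ⟦ y ∈? C ⟧) ⟩
    ∑[ y < v ] ⟦ y ∈? C ⟧
      ≡⟨ ∣p∣≡∑ C ⟨
    ∣ C ∣ ∎
    where
    open ℕ.≤-Reasoning
    common≤1 : ∀ y → y ∈ C → ∑[ i < b ] (inc y i * inc x i) ℕ.≤ 1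
    common≤1 y y∈C = ℕ.≤-trans
      (ℕ.≤-reflexive (sum-cong-≗ λ i → sym (⟦⟧-× (y ∈? lookup ℬ i) (x ∈? lookup ℬ i))))
      (⟦⟧-unique (λ i → (y ∈? lookup ℬ i) ×-dec (x ∈? lookup ℬ i))
        λ i j (y∈i , x∈i) (y∈j , x∈j) → pair-≤1 y x (λ { refl → x∉C y∈C }) i y∈i x∈i j y∈j x∈j)

  -- The preceding bound, taken for `D`, is summed over the points of `C`: disjointness makes the
  -- two points of every pair distinct.
  ∑-meet*meet : ∀ C D → (∀ {x} → x ∈ C → x ∉ D) →
                ∑[ i < b ] (meet C i * meet D i) ℕ.≤ ∣ C ∣ * ∣ D ∣
  ∑-meet*meet C D disjoint = begin
    ∑[ i < b ] (meet C i * meet D i)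
      ≡⟨ weighted-∑-comm (λ x → ⟦ x ∈? C ⟧) inc (meet D) ⟩
    ∑[ x < v ] (⟦ x ∈? C ⟧ * ∑[ i < b ] (inc x i * meet D i))
      ≤⟨ sum-mono (λ x → ⟦⟧*-mono (x ∈? C) (λ x∈C → ℕ.≤-trans
           (ℕ.≤-reflexive (sum-cong-≗ λ i → ℕ.*-comm (inc x i) (meet D i)))
           (∑-meet*inc≤∣C∣ D (disjoint x∈C)))) ⟩
    ∑[ x < v ] (⟦ x ∈? C ⟧ * ∣ D ∣)
      ≡⟨ *-distribʳ-sum ∣ D ∣ (λ x → ⟦ x ∈? C ⟧) ⟨
    (∑[ x < v ] ⟦ x ∈? C ⟧) * ∣ D ∣
      ≡⟨ cong (_* ∣ D ∣) (∣p∣≡∑ C) ⟨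
    ∣ C ∣ * ∣ D ∣ ∎
    where open ℕ.≤-Reasoning

  -- Each block through `x` has `k ∸ 1` further points, and no two such blocks share one of them.
  degree-bound : ∀ x → (∑[ i < b ] inc x i) * (k ∸ 1) ℕ.≤ v ∸ 1
  degree-bound x = begin
    (∑[ i < b ] inc x i) * (k ∸ 1)
      ≡⟨ *-distribʳ-sum (k ∸ 1) (inc x) ⟩
    ∑[ i < b ] (inc x i * (k ∸ 1))
      ≤⟨ sum-mono (λ i → ℕ.≤-trans (ℕ.*-monoʳ-≤ (inc x i) (others i))
                                   (ℕ.≤-reflexive (ℕ.*-comm (inc x i) _))) ⟩
    ∑[ i < b ] (meet (∁ ⁅ x ⁆) i * inc x i)
      ≤⟨ ∑-meet*inc≤∣C∣ (∁ ⁅ x ⁆) (x∈p⇒x∉∁p (x∈⁅x⁆ x)) ⟩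
    ∣ ∁ ⁅ x ⁆ ∣
      ≡⟨ trans (∣∁p∣≡n∸∣p∣ ⁅ x ⁆) (cong (v ∸_) (∣⁅x⁆∣≡1 x)) ⟩
    v ∸ 1 ∎
    where
    open ℕ.≤-Reasoning
    split : ∀ i y → inc y i ℕ.≤ ⟦ y Fin.≟ x ⟧ ℕ.+ ⟦ y ∈? ∁ ⁅ x ⁆ ⟧ * inc y i
    split i y with y Fin.≟ x
    ... | yes _ = ℕ.≤-trans (inc≤1 (y ∈? lookup ℬ i)) (ℕ.m≤m+n 1 _)
      where
      inc≤1 : (d : Dec (y ∈ lookup ℬ i)) → ⟦ d ⟧ ℕ.≤ 1
      inc≤1 (yes _) = ℕ.≤-refl
      inc≤1 (no _)  = z≤n
    ... | no y≢x = ℕ.≤-reflexive (sym (trans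
      (cong (_* inc y i) (⟦⟧-yes (y ∈? ∁ ⁅ x ⁆) (x∉p⇒x∈∁p (y≢x ∘ x∈⁅y⁆⇒x≡y x))))
      (ℕ.*-identityˡ (inc y i))))
    others : ∀ i → k ∸ 1 ℕ.≤ meet (∁ ⁅ x ⁆) i
    others i = ℕ.m≤n+o⇒m∸n≤o k 1 (begin
      k                                               ≡⟨ ∑-inc i ⟨
      ∑[ y < v ] inc y i                              ≤⟨ sum-mono (split i) ⟩
      ∑[ y < v ] (⟦ y Fin.≟ x ⟧ ℕ.+ ⟦ y ∈? ∁ ⁅ x ⁆ ⟧ * inc y i)
        ≡⟨ ∑-distrib-+ (λ y → ⟦ y Fin.≟ x ⟧) (λ y → ⟦ y ∈? ∁ ⁅ x ⁆ ⟧ * inc y i) ⟩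
      ∑[ y < v ] ⟦ y Fin.≟ x ⟧ ℕ.+ meet (∁ ⁅ x ⁆) i   ≡⟨ cong (ℕ._+ meet (∁ ⁅ x ⁆) i) (∑-⟦≟⟧ x) ⟩
      1 ℕ.+ meet (∁ ⁅ x ⁆) i                          ∎)

  -- For `x` in `p`, some member `j` misses `x`. All members through `x` meet `j`, and `x` lies with
  -- each of the `k` points of `j` in at most one block, so at most `k` members contain `x`. All
  -- members meet `p`, so there are at most `k * k` incidences with points of `p`, of which `p`
  -- itself uses `k` instead of one. This leaves at most `k * k - k + 1` members.
  intersecting-family-bound : {U : Fin b → Set} (U? : Decidable U) →
    (∀ {i j} → U i → U j → i ≢ j → Nonempty (lookup ℬ i ∩ lookup ℬ j)) →
    ∀ {p} → U p → (∀ x → x ∈ lookup ℬ p → ∃[ j ] U j × x ∉ lookup ℬ j) →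
    ∑[ i < b ] ⟦ U? i ⟧ ℕ.+ k ℕ.≤ k * k ℕ.+ 1
  intersecting-family-bound {U} U? intersecting {p} Up escape = begin
    ∑[ i < b ] u i ℕ.+ k
      ≡⟨ cong (∑[ i < b ] u i ℕ.+_) (trans (cong (_* k) (∑-⟦≟⟧ p)) (ℕ.*-identityˡ k)) ⟨
    ∑[ i < b ] u i ℕ.+ (∑[ i < b ] ⟦ i Fin.≟ p ⟧) * k
      ≡⟨ cong (∑[ i < b ] u i ℕ.+_) (*-distribʳ-sum k (λ i → ⟦ i Fin.≟ p ⟧)) ⟩
    ∑[ i < b ] u i ℕ.+ ∑[ i < b ] (⟦ i Fin.≟ p ⟧ * k)
      ≡⟨ ∑-distrib-+ u (λ i → ⟦ i Fin.≟ p ⟧ * k) ⟨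
    ∑[ i < b ] (u i ℕ.+ ⟦ i Fin.≟ p ⟧ * k)
      ≤⟨ sum-mono pointwise ⟩
    ∑[ i < b ] (meet (lookup ℬ p) i * u i ℕ.+ ⟦ i Fin.≟ p ⟧)
      ≡⟨ ∑-distrib-+ (λ i → meet (lookup ℬ p) i * u i) (λ i → ⟦ i Fin.≟ p ⟧) ⟩
    ∑[ i < b ] (meet (lookup ℬ p) i * u i) ℕ.+ ∑[ i < b ] ⟦ i Fin.≟ p ⟧
      ≡⟨ cong₂ ℕ._+_ (weighted-∑-comm (λ x → inc x p) inc u) (∑-⟦≟⟧ p) ⟩
    ∑[ x < v ] (inc x p * ∑[ i < b ] (inc x i * u i)) ℕ.+ 1
      ≤⟨ ℕ.+-monoˡ-≤ 1 (sum-mono λ x → ⟦⟧*-mono (x ∈? lookup ℬ p) (through x)) ⟩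
    ∑[ x < v ] (inc x p * k) ℕ.+ 1
      ≡⟨ cong (ℕ._+ 1) (trans (sym (*-distribʳ-sum k (λ x → inc x p))) (cong (_* k) (∑-inc p))) ⟩
    k * k ℕ.+ 1 ∎
    where
    open ℕ.≤-Reasoning
    u : Fin b → ℕ
    u i = ⟦ U? i ⟧
    meets : ∀ {i j} → U i → U j → i ≢ j → 1 ℕ.≤ meet (lookup ℬ j) i
    meets {i} {j} Ui Uj i≢j with x , x∈ ← intersecting Ui Uj i≢j
      with x∈i , x∈j ← x∈p∩q⁻ (lookup ℬ i) (lookup ℬ j) x∈ = meet-positive x∈j x∈i
    -- The two brackets correct the count at `i = p`, which meets itself in `k` points but is one
    -- member; there equality holds.
    pointwise : ∀ i → u i ℕ.+ ⟦ i Fin.≟ p ⟧ * k ℕ.≤ meet (lookup ℬ p) i * u i ℕ.+ ⟦ i Fin.≟ p ⟧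
    pointwise i with i Fin.≟ p
    ... | yes refl rewrite ⟦⟧-yes (U? p) Up | meet-self p = ℕ.≤-reflexive (solve-k k)
      where
      solve-k : ∀ k → 1 ℕ.+ 1 * k ≡ k * 1 ℕ.+ 1
      solve-k = solve-∀
    ... | no i≢p = ℕ.+-monoˡ-≤ 0 (ℕ.≤-trans
      (ℕ.≤-reflexive (sym (ℕ.*-identityʳ (u i))))
      (ℕ.≤-trans (⟦⟧*-mono (U? i) λ Ui → meets Ui Up i≢p)
                 (ℕ.≤-reflexive (ℕ.*-comm (u i) _))))
    through : ∀ x → x ∈ lookup ℬ p → ∑[ i < b ] (inc x i * u i) ℕ.≤ k
    through x x∈p with j , Uj , x∉j ← escape x x∈p = begin
      ∑[ i < b ] (inc x i * u i)
        ≤⟨ sum-mono (λ i → ⟦⟧*-mono (x ∈? lookup ℬ i) (hits i)) ⟩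
      ∑[ i < b ] (inc x i * meet (lookup ℬ j) i)
        ≡⟨ sum-cong-≗ (λ i → ℕ.*-comm (inc x i) _) ⟩
      ∑[ i < b ] (meet (lookup ℬ j) i * inc x i)
        ≤⟨ ∑-meet*inc≤∣C∣ (lookup ℬ j) x∉j ⟩
      ∣ lookup ℬ j ∣ ≡⟨ block-size j ⟩
      k ∎
      where
      hits : ∀ i → x ∈ lookup ℬ i → u i ℕ.≤ meet (lookup ℬ j) i
      hits i x∈i with U? i
      ... | no _   = z≤n
      ... | yes Ui = meets Ui Uj λ { refl → x∉j x∈i }

-- Blocks private to a member of a maximum partial parallel class

module MaximumPPC {v b ρ : ℕ} {ℬ : Vec (Subset v) b} (packing : IsPacking 4 ℬ)
                  {S : Subset b} (ppc : IsPPC ℬ S) (∣S∣≡ρ : ∣ S ∣ ≡ ρ)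
                  (maximal : ¬ HasPPC ℬ (suc ρ)) where
  open IsPacking packing
  open Incidence packing

  -- The condition `q ≢ p` exempts intersections with `p`: a member `p` of `S` is private to itself,
  -- and any block private to it can take its place in `S`.
  Touches : Fin b → Fin b → Set
  Touches p i = ∃[ q ] q ∈ S × q ≢ p × Nonempty (lookup ℬ i ∩ lookup ℬ q)

  touches? : ∀ p → Decidable (Touches p)
  touches? p i = any? λ q →
    (q ∈? S) ×-dec (¬? (q Fin.≟ p) ×-dec nonempty? (lookup ℬ i ∩ lookup ℬ q))

  Private : Fin b → Fin b → Set
  Private p i = ¬ Touches p i

  private? : ∀ p → Decidable (Private p)
  private? p i = ¬? (touches? p i)

  private-self : ∀ {p} → p ∈ S → Private p p
  private-self p∈S (q , q∈S , q≢p , ne) = ppc _ q p∈S q∈S (q≢p ∘ sym) ne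

  -- A block of `S` other than `p` touches itself, being nonempty.
  private∉S : ∀ {p i} → Private p i → i ≢ p → i ∉ S
  private∉S {i = i} Pi i≢p i∈S
    with x , x∈i ← ∣p∣>0⇒Nonempty (lookup ℬ i) (subst (1 ℕ.≤_) (sym (block-size i)) (s≤s z≤n))
    = Pi (i , i∈S , i≢p , x , x∈p∩q⁺ (x∈i , x∈i))

  -- Otherwise replacing p by i and j would enlarge the partial parallel class.
  private-intersecting : ∀ {p} → p ∈ S → ∀ {i j} → Private p i → Private p j → i ≢ j →
                         Nonempty (lookup ℬ i ∩ lookup ℬ j)
  private-intersecting {p} p∈S {i} {j} Pi Pj i≢j =
    decidable-stable (nonempty? _) λ empty → maximal (T , T-ppc empty , ∣T∣)
    where
    S′ S″ T : Subset b
    S′ = S [ p ]≔ outside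
    S″ = S′ [ i ]≔ inside
    T  = S″ [ j ]≔ inside

    -- Here `l` may be `p`, which was removed first; so the exchange also works when `i` or `j` is
    -- `p`.
    ∉S′ : ∀ {l} → Private p l → l ∉ S′
    ∉S′ Pl l∈S′ with l≢p , l∈S ← ∈-[]≔outside S l∈S′ = private∉S Pl l≢p l∈S

    j∉S″ : j ∉ S″
    j∉S″ j∈ with ∈-[]≔inside S′ j∈
    ... | inj₁ j≡i  = i≢j (sym j≡i)
    ... | inj₂ j∈S′ = ∉S′ Pj j∈S′

    ∣T∣ : ∣ T ∣ ≡ suc ρ
    ∣T∣ = trans (∣p[x]≔inside∣ S″ j∉S″) (cong suc
         (trans (∣p[x]≔inside∣ S′ (∉S′ Pi)) (trans (∣p[x]≔outside∣ S p∈S) ∣S∣≡ρ)))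

    ∈T : ∀ {l} → l ∈ T → l ≡ j ⊎ l ≡ i ⊎ (l ≢ p × l ∈ S)
    ∈T l∈T with ∈-[]≔inside S″ l∈T
    ... | inj₁ l≡j = inj₁ l≡j
    ... | inj₂ l∈S″ with ∈-[]≔inside S′ l∈S″
    ...   | inj₁ l≡i  = inj₂ (inj₁ l≡i)
    ...   | inj₂ l∈S′ = inj₂ (inj₂ (∈-[]≔outside S l∈S′))

    ∩-comm : ∀ {l m} → Nonempty (lookup ℬ l ∩ lookup ℬ m) → Nonempty (lookup ℬ m ∩ lookup ℬ l)
    ∩-comm {l} {m} (x , x∈) with x∈l , x∈m ← x∈p∩q⁻ (lookup ℬ l) (lookup ℬ m) x∈ =
      x , x∈p∩q⁺ (x∈m , x∈l)

    T-ppc : Empty (lookup ℬ i ∩ lookup ℬ j) → IsPPC ℬ T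
    T-ppc empty l m l∈T m∈T l≢m ne with ∈T l∈T | ∈T m∈T
    ... | inj₁ refl               | inj₁ refl               = l≢m refl
    ... | inj₁ refl               | inj₂ (inj₁ refl)        = empty (∩-comm ne)
    ... | inj₁ refl               | inj₂ (inj₂ (m≢p , m∈S)) = Pj (m , m∈S , m≢p , ne)
    ... | inj₂ (inj₁ refl)        | inj₁ refl               = empty ne
    ... | inj₂ (inj₁ refl)        | inj₂ (inj₁ refl)        = l≢m refl
    ... | inj₂ (inj₁ refl)        | inj₂ (inj₂ (m≢p , m∈S)) = Pi (m , m∈S , m≢p , ne)
    ... | inj₂ (inj₂ (l≢p , l∈S)) | inj₁ refl               = Pj (l , l∈S , l≢p , ∩-comm ne)
    ... | inj₂ (inj₂ (l≢p , l∈S)) | inj₂ (inj₁ refl)        = Pi (l , l∈S , l≢p , ∩-comm ne)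
    ... | inj₂ (inj₂ (l≢p , l∈S)) | inj₂ (inj₂ (m≢p , m∈S)) = ppc l m l∈S m∈S l≢m ne

  -- Stars and spread members

  Escape : Fin b → Fin v → Set
  Escape p x = ∃[ i ] Private p i × x ∉ lookup ℬ i

  escape? : ∀ p → Decidable (Escape p)
  escape? p x = any? λ i → private? p i ×-dec ¬? (x ∈? lookup ℬ i)

  -- `absent` lets later sums run over all block indices instead of over `S`. The second field of
  -- `spread` is the hypothesis that `intersecting-family-bound` needs.
  data Kind (p : Fin b) : Set where
    absent : p ∉ S → Kind p
    star   : p ∈ S → ∀ x → x ∈ lookup ℬ p → (∀ i → Private p i → x ∈ lookup ℬ i) → Kind p
    spread : p ∈ S → (∀ x → x ∈ lookup ℬ p → Escape p x) → Kind p

  kind : ∀ p → Kind p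
  kind p with p ∈? S
  ... | no  p∉S = absent p∉S
  ... | yes p∈S with any? (λ x → (x ∈? lookup ℬ p) ×-dec ¬? (escape? p x))
  ...   | yes (x , x∈p , ¬esc) = star p∈S x x∈p λ i Pi →
            decidable-stable (x ∈? lookup ℬ i) λ x∉i → ¬esc (i , Pi , x∉i)
  ...   | no ¬centre = spread p∈S λ x x∈p →
            decidable-stable (escape? p x) λ ¬esc → ¬centre (x , x∈p , ¬esc)

  -- `stars` and `spreads` are indicators. `points` bounds the size of `rest`, and is linear in them
  -- so that its total is `3 * s + 4 * t`.
  stars spreads points : ∀ {p} → Kind p → ℕ
  stars   (absent _)     = 0
  stars   (star _ _ _ _) = 1
  stars   (spread _ _)   = 0
  spreads (absent _)     = 0
  spreads (star _ _ _ _) = 0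
  spreads (spread _ _)   = 1
  points κ = 3 * stars κ ℕ.+ 4 * spreads κ

  -- The blocks charged to `p`: for a star all blocks through its centre, private or not; for a
  -- spread member only its private blocks.
  cover : ∀ {p} → Kind p → Fin b → ℕ
  cover     (absent _)     i = 0
  cover     (star _ x _ _) i = inc x i
  cover {p} (spread _ _)   i = ⟦ private? p i ⟧

  -- The points of `p` left for crossings. The centre of a star is dropped because every block
  -- through it is already charged to `p`.
  rest : ∀ {p} → Kind p → Subset v
  rest     (absent _)     = ⊥
  rest {p} (star _ x _ _) = lookup ℬ p ∖ x
  rest {p} (spread _ _)   = lookup ℬ p

  stars+spreads : ∀ {p} (κ : Kind p) → stars κ ℕ.+ spreads κ ≡ ⟦ p ∈? S ⟧
  stars+spreads (absent p∉S)     = sym (⟦⟧-no (_ ∈? S) p∉S)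
  stars+spreads (star p∈S _ _ _) = sym (⟦⟧-yes (_ ∈? S) p∈S)
  stars+spreads (spread p∈S _)   = sym (⟦⟧-yes (_ ∈? S) p∈S)

  -- There is no cross term, since at most one of the two indicators is 1.
  points² : ∀ {p} (κ : Kind p) → points κ * points κ ≡ 9 * stars κ ℕ.+ 16 * spreads κ
  points² (absent _)     = refl
  points² (star _ _ _ _) = refl
  points² (spread _ _)   = refl

  ∣rest∣≤points : ∀ {p} (κ : Kind p) → ∣ rest κ ∣ ℕ.≤ points κ
  ∣rest∣≤points (absent _)           = ℕ.≤-reflexive (∣⊥∣≡0 v)
  ∣rest∣≤points {p} (star _ x x∈p _) =
    ℕ.≤-pred (subst (∣ lookup ℬ p ∖ x ∣ ℕ.<_) (block-size p) (x∈p⇒∣p-x∣<∣p∣ x∈p))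
  ∣rest∣≤points {p} (spread _ _)     = ℕ.≤-reflexive (block-size p)

  rest⊆block : ∀ {p x} (κ : Kind p) → x ∈ rest κ → p ∈ S × x ∈ lookup ℬ p
  rest⊆block (absent _)           x∈ = contradiction x∈ ∉⊥
  rest⊆block {p} (star p∈S c _ _) x∈ = p∈S , p─q⊆p (lookup ℬ p) ⁅ c ⁆ x∈
  rest⊆block (spread p∈S _)       x∈ = p∈S , x∈

  rest-disjoint : ∀ {p q x} → p ≢ q → (κ : Kind p) (κ′ : Kind q) → x ∈ rest κ → x ∉ rest κ′
  rest-disjoint {p} {q} {x} p≢q κ κ′ x∈κ x∈κ′
    with p∈S , x∈p ← rest⊆block κ x∈κ | q∈S , x∈q ← rest⊆block κ′ x∈κ′
    = ppc p q p∈S q∈S p≢q (x , x∈p∩q⁺ (x∈p , x∈q))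

  -- The factor 3 clears the denominator of `(v - 1) / 3`, and `stars κ` on the left stands for the
  -- subtracted 1.
  ∑-cover : 1 ℕ.≤ v → ∀ {p} (κ : Kind p) →
            (∑[ i < b ] cover κ i) * 3 ℕ.+ stars κ ℕ.≤ stars κ * v ℕ.+ 39 * spreads κ
  ∑-cover 1≤v (absent _) =
    ℕ.≤-reflexive (cong (λ n → n * 3 ℕ.+ 0) (trans (sum-const b 0) (ℕ.*-zeroʳ b)))
  ∑-cover 1≤v (star _ x _ _) = begin
    (∑[ i < b ] inc x i) * 3 ℕ.+ 1  ≤⟨ ℕ.+-monoˡ-≤ 1 (degree-bound x) ⟩
    v ∸ 1 ℕ.+ 1                     ≡⟨ ℕ.m∸n+n≡m 1≤v ⟩
    v                               ≡⟨ sym (trans (ℕ.+-identityʳ _) (ℕ.*-identityˡ v)) ⟩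
    1 * v ℕ.+ 0                     ∎
    where open ℕ.≤-Reasoning
  -- With `k = 4` the family has at most `17 - 4 = 13` blocks, and `39 = 3 * 13`.
  ∑-cover 1≤v {p} (spread p∈S escape) = ℕ.≤-trans (ℕ.≤-reflexive (ℕ.+-identityʳ _))
    (ℕ.*-monoˡ-≤ 3 (ℕ.+-cancelʳ-≤ 4 _ 13
      (intersecting-family-bound (private? p) (private-intersecting p∈S) (private-self p∈S) escape)))

  -- Every block is covered or crosses two members

  covered-by-private : ∀ {p i} → p ∈ S → (κ : Kind p) → Private p i → 1 ℕ.≤ cover κ i
  covered-by-private p∈S (absent p∉S) Pi = contradiction p∈S p∉S
  covered-by-private {i = i} _ (star _ x _ centre) Pi =
    ℕ.≤-reflexive (sym (⟦⟧-yes (x ∈? lookup ℬ i) (centre i Pi)))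
  covered-by-private {p} {i} _ (spread _ _) Pi =
    ℕ.≤-reflexive (sym (⟦⟧-yes (private? p i) Pi))

  covered-or-meets : ∀ {q i} → q ∈ S → (κ : Kind q) → Nonempty (lookup ℬ i ∩ lookup ℬ q) →
                     1 ℕ.≤ cover κ i ⊎ 1 ℕ.≤ meet (rest κ) i
  covered-or-meets {q} {i} q∈S κ (x , x∈)
    with x∈i , x∈q ← x∈p∩q⁻ (lookup ℬ i) (lookup ℬ q) x∈ = by-kind κ
    where
    by-kind : (κ : Kind q) → 1 ℕ.≤ cover κ i ⊎ 1 ℕ.≤ meet (rest κ) i
    by-kind (absent q∉S)   = contradiction q∈S q∉S
    by-kind (spread _ _)   = inj₂ (meet-positive x∈q x∈i)
    by-kind (star _ c _ _) with c ∈? lookup ℬ i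
    ... | yes _  = inj₁ ℕ.≤-refl
    ... | no c∉i = inj₂ (meet-positive (x∈p∧x≢y⇒x∈p-y x∈q λ { refl → c∉i x∈i }) x∈i)

  -- The member `p`, which exists since `1 ≤ ρ`, only starts the search. A block not private to `p`
  -- meets some `q` in `S`; if it is not private to `q` either, it meets some `r ≢ q`. Unless it is
  -- covered at `q` or `r`, it meets both in their `rest`.
  covered-or-crossing : 1 ℕ.≤ ρ → ∀ i → (∃[ p ] 1 ℕ.≤ cover (kind p) i) ⊎
    (∃[ q ] ∃[ r ] q ≢ r × 1 ℕ.≤ meet (rest (kind q)) i × 1 ℕ.≤ meet (rest (kind r)) i)
  covered-or-crossing 1≤ρ i
    with p , p∈S ← ∣p∣>0⇒Nonempty S (subst (1 ℕ.≤_) (sym ∣S∣≡ρ) 1≤ρ)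
    with touches? p i
  ... | no Pi = inj₁ (p , covered-by-private p∈S (kind p) Pi)
  ... | yes (q , q∈S , _ , meets-q) with touches? q i
  ...   | no Pi = inj₁ (q , covered-by-private q∈S (kind q) Pi)
  ...   | yes (r , r∈S , r≢q , meets-r)
          with covered-or-meets q∈S (kind q) meets-q | covered-or-meets r∈S (kind r) meets-r
  ...     | inj₁ covered | _            = inj₁ (q , covered)
  ...     | inj₂ _       | inj₁ covered = inj₁ (r , covered)
  ...     | inj₂ 1≤q     | inj₂ 1≤r     = inj₂ (q , r , r≢q ∘ sym , 1≤q , 1≤r)

  coverage : Fin b → ℕ
  coverage i = ∑[ p < b ] cover (kind p) i

  crossing : Fin b → Fin b → Fin b → ℕ
  crossing i p q = ⟦ ¬? (p Fin.≟ q) ⟧ * (meet (rest (kind p)) i * meet (rest (kind q)) i)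

  crossings : Fin b → ℕ
  crossings i = ∑[ p < b ] ∑[ q < b ] crossing i p q

  -- A covered block gets 2 from the doubled coverage. Any other block gets 1 from each of the
  -- ordered pairs `(q , r)` and `(r , q)`.
  block-weight : 1 ℕ.≤ ρ → ∀ i → 2 ℕ.≤ 2 * coverage i ℕ.+ crossings i
  block-weight 1≤ρ i with covered-or-crossing 1≤ρ i
  ... | inj₁ (p , 1≤p) = ℕ.m≤n⇒m≤n+o _
          (ℕ.*-monoʳ-≤ 2 (ℕ.≤-trans 1≤p (term≤sum (λ p → cover (kind p) i) p)))
  ... | inj₂ (q , r , q≢r , 1≤q , 1≤r) = ℕ.m≤n⇒m≤o+n _ (ℕ.≤-trans
          (ℕ.+-mono-≤ (row q≢r 1≤q 1≤r) (row (q≢r ∘ sym) 1≤r 1≤q))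
          (two-terms≤sum (λ p → ∑[ q < b ] crossing i p q) q≢r))
    where
    row : ∀ {q r} → q ≢ r → 1 ℕ.≤ meet (rest (kind q)) i → 1 ℕ.≤ meet (rest (kind r)) i →
          1 ℕ.≤ ∑[ r < b ] crossing i q r
    row {q} {r} q≢r 1≤q 1≤r = ℕ.≤-trans
      (ℕ.*-mono-≤ (ℕ.≤-reflexive (sym (⟦⟧-yes (¬? (q Fin.≟ r)) q≢r))) (ℕ.*-mono-≤ 1≤q 1≤r))
      (term≤sum (crossing i q) r)

  -- Summation over all blocks and members

  s t : ℕ
  s = ∑[ p < b ] stars (kind p)
  t = ∑[ p < b ] spreads (kind p)

  s+t≡ρ : s ℕ.+ t ≡ ρ
  s+t≡ρ = begin
    s ℕ.+ t                                                ≡⟨ ∑-distrib-+ (stars ∘ kind) (spreads ∘ kind) ⟨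
    ∑[ p < b ] (stars (kind p) ℕ.+ spreads (kind p))       ≡⟨ sum-cong-≗ (stars+spreads ∘ kind) ⟩
    ∑[ p < b ] ⟦ p ∈? S ⟧                                  ≡⟨ ∣p∣≡∑ S ⟨
    ∣ S ∣                                                  ≡⟨ ∣S∣≡ρ ⟩
    ρ ∎
    where open ≡-Reasoning

  ∑-linear : ∀ c d → ∑[ p < b ] (c * stars (kind p) ℕ.+ d * spreads (kind p)) ≡ c * s ℕ.+ d * t
  ∑-linear c d = trans
    (∑-distrib-+ (λ p → c * stars (kind p)) (λ p → d * spreads (kind p)))
    (sym (cong₂ ℕ._+_ (*-distribˡ-sum c (stars ∘ kind)) (*-distribˡ-sum d (spreads ∘ kind))))

  pairs : Fin b → Fin b → ℕ
  pairs p q = points (kind p) * points (kind q)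

  Q : ℕ
  Q = ∑[ p < b ] ∑[ q < b ] (⟦ ¬? (p Fin.≟ q) ⟧ * pairs p q)

  -- `Q` is the square of the total of `points` without its diagonal, and by `points²` the diagonal
  -- sums to `9 * s + 16 * t`.
  Q-identity : Q ℕ.+ (9 * s ℕ.+ 16 * t) ≡ (3 * s ℕ.+ 4 * t) * (3 * s ℕ.+ 4 * t)
  Q-identity = begin
    Q ℕ.+ (9 * s ℕ.+ 16 * t)
      ≡⟨ cong (Q ℕ.+_) (sym (∑-linear 9 16)) ⟩
    Q ℕ.+ ∑[ p < b ] (9 * stars (kind p) ℕ.+ 16 * spreads (kind p))
      ≡⟨ ∑-distrib-+ (λ p → ∑[ q < b ] (⟦ ¬? (p Fin.≟ q) ⟧ * pairs p q)) _ ⟨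
    ∑[ p < b ] (∑[ q < b ] (⟦ ¬? (p Fin.≟ q) ⟧ * pairs p q) ℕ.+ (9 * stars (kind p) ℕ.+ 16 * spreads (kind p)))
      ≡⟨ sum-cong-≗ row ⟩
    ∑[ p < b ] (points (kind p) * z)
      ≡⟨ *-distribʳ-sum z (points ∘ kind) ⟨
    z * z
      ≡⟨ cong₂ _*_ (∑-linear 3 4) (∑-linear 3 4) ⟩
    (3 * s ℕ.+ 4 * t) * (3 * s ℕ.+ 4 * t) ∎
    where
    open ≡-Reasoning
    z : ℕ
    z = ∑[ p < b ] points (kind p)
    diagonal : ∀ p → ∑[ q < b ] (⟦ q Fin.≟ p ⟧ * pairs p p) ≡ 9 * stars (kind p) ℕ.+ 16 * spreads (kind p)
    diagonal p = begin
      ∑[ q < b ] (⟦ q Fin.≟ p ⟧ * pairs p p)    ≡⟨ *-distribʳ-sum (pairs p p) (λ q → ⟦ q Fin.≟ p ⟧) ⟨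
      (∑[ q < b ] ⟦ q Fin.≟ p ⟧) * pairs p p    ≡⟨ cong (_* pairs p p) (∑-⟦≟⟧ p) ⟩
      1 * pairs p p                             ≡⟨ ℕ.*-identityˡ _ ⟩
      pairs p p                                 ≡⟨ points² (kind p) ⟩
      9 * stars (kind p) ℕ.+ 16 * spreads (kind p) ∎
    entry : ∀ p q → ⟦ ¬? (p Fin.≟ q) ⟧ * pairs p q ℕ.+ ⟦ q Fin.≟ p ⟧ * pairs p p ≡ pairs p q
    entry p q with p Fin.≟ q
    ... | yes refl = trans (cong (_* pairs p p) (⟦⟧-yes (p Fin.≟ p) refl)) (ℕ.*-identityˡ _)
    ... | no p≢q   = trans (cong₂ ℕ._+_ (ℕ.*-identityˡ (pairs p q))
                             (cong (_* pairs p p) (⟦⟧-no (q Fin.≟ p) (p≢q ∘ sym))))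
                           (ℕ.+-identityʳ _)
    row : ∀ p → ∑[ q < b ] (⟦ ¬? (p Fin.≟ q) ⟧ * pairs p q)
                ℕ.+ (9 * stars (kind p) ℕ.+ 16 * spreads (kind p))
              ≡ points (kind p) * z
    row p = begin
      ∑[ q < b ] (⟦ ¬? (p Fin.≟ q) ⟧ * pairs p q) ℕ.+ (9 * stars (kind p) ℕ.+ 16 * spreads (kind p))
        ≡⟨ cong (∑[ q < b ] (⟦ ¬? (p Fin.≟ q) ⟧ * pairs p q) ℕ.+_) (diagonal p) ⟨
      ∑[ q < b ] (⟦ ¬? (p Fin.≟ q) ⟧ * pairs p q) ℕ.+ ∑[ q < b ] (⟦ q Fin.≟ p ⟧ * pairs p p)
        ≡⟨ ∑-distrib-+ (λ q → ⟦ ¬? (p Fin.≟ q) ⟧ * pairs p q) _ ⟨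
      ∑[ q < b ] (⟦ ¬? (p Fin.≟ q) ⟧ * pairs p q ℕ.+ ⟦ q Fin.≟ p ⟧ * pairs p p)
        ≡⟨ sum-cong-≗ (entry p) ⟩
      ∑[ q < b ] pairs p q
        ≡⟨ *-distribˡ-sum (points (kind p)) (points ∘ kind) ⟨
      points (kind p) * z ∎

  -- Distinct members have disjoint `rest`, so `∑-meet*meet` bounds the crossings of each ordered
  -- pair.
  ∑-crossings : ∑[ i < b ] crossings i ℕ.≤ Q
  ∑-crossings = begin
    ∑[ i < b ] ∑[ p < b ] ∑[ q < b ] crossing i p q
      ≡⟨ ∑-comm (λ i p → ∑[ q < b ] crossing i p q) ⟩
    ∑[ p < b ] ∑[ i < b ] ∑[ q < b ] crossing i p q
      ≡⟨ sum-cong-≗ (λ p → ∑-comm (λ i q → crossing i p q)) ⟩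
    ∑[ p < b ] ∑[ q < b ] ∑[ i < b ] crossing i p q
      ≤⟨ sum-mono (λ p → sum-mono (bound p)) ⟩
    Q ∎
    where
    open ℕ.≤-Reasoning
    bound : ∀ p q → ∑[ i < b ] crossing i p q ℕ.≤ ⟦ ¬? (p Fin.≟ q) ⟧ * pairs p q
    bound p q = begin
      ∑[ i < b ] crossing i p q
        ≡⟨ *-distribˡ-sum ⟦ ¬? (p Fin.≟ q) ⟧ (λ i → meet (rest (kind p)) i * meet (rest (kind q)) i) ⟨
      ⟦ ¬? (p Fin.≟ q) ⟧ * ∑[ i < b ] (meet (rest (kind p)) i * meet (rest (kind q)) i)
        ≤⟨ ⟦⟧*-mono (¬? (p Fin.≟ q)) (λ p≢q → ℕ.≤-trans
             (∑-meet*meet (rest (kind p)) (rest (kind q)) (rest-disjoint p≢q (kind p) (kind q)))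
             (ℕ.*-mono-≤ (∣rest∣≤points (kind p)) (∣rest∣≤points (kind q)))) ⟩
      ⟦ ¬? (p Fin.≟ q) ⟧ * pairs p q ∎

  ∑-coverage : 1 ℕ.≤ v → (∑[ i < b ] coverage i) * 3 ℕ.+ s ℕ.≤ s * v ℕ.+ 39 * t
  ∑-coverage 1≤v = begin
    (∑[ i < b ] coverage i) * 3 ℕ.+ s
      ≡⟨ cong (λ n → n * 3 ℕ.+ s) (∑-comm (λ i p → cover (kind p) i)) ⟩
    (∑[ p < b ] ∑[ i < b ] cover (kind p) i) * 3 ℕ.+ s
      ≡⟨ cong (ℕ._+ s) (*-distribʳ-sum 3 (λ p → ∑[ i < b ] cover (kind p) i)) ⟩
    ∑[ p < b ] ((∑[ i < b ] cover (kind p) i) * 3) ℕ.+ s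
      ≡⟨ ∑-distrib-+ (λ p → (∑[ i < b ] cover (kind p) i) * 3) (stars ∘ kind) ⟨
    ∑[ p < b ] ((∑[ i < b ] cover (kind p) i) * 3 ℕ.+ stars (kind p))
      ≤⟨ sum-mono (λ p → ∑-cover 1≤v (kind p)) ⟩
    ∑[ p < b ] (stars (kind p) * v ℕ.+ 39 * spreads (kind p))
      ≡⟨ ∑-distrib-+ (λ p → stars (kind p) * v) (λ p → 39 * spreads (kind p)) ⟩
    ∑[ p < b ] (stars (kind p) * v) ℕ.+ ∑[ p < b ] (39 * spreads (kind p))
      ≡⟨ cong₂ ℕ._+_ (*-distribʳ-sum v (stars ∘ kind)) (*-distribˡ-sum 39 (spreads ∘ kind)) ⟨
    s * v ℕ.+ 39 * t ∎
    where open ℕ.≤-Reasoning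

  weighted-block-count : 1 ℕ.≤ ρ → b * 2 ℕ.≤ 2 * (∑[ i < b ] coverage i) ℕ.+ Q
  weighted-block-count 1≤ρ = begin
    b * 2
      ≡⟨ sum-const b 2 ⟨
    ∑[ i < b ] 2
      ≤⟨ sum-mono (block-weight 1≤ρ) ⟩
    ∑[ i < b ] (2 * coverage i ℕ.+ crossings i)
      ≡⟨ ∑-distrib-+ (λ i → 2 * coverage i) crossings ⟩
    ∑[ i < b ] (2 * coverage i) ℕ.+ ∑[ i < b ] crossings i
      ≤⟨ ℕ.+-mono-≤ (ℕ.≤-reflexive (sym (*-distribˡ-sum 2 coverage))) ∑-crossings ⟩
    2 * (∑[ i < b ] coverage i) ℕ.+ Q ∎
    where open ℕ.≤-Reasoning

-- Comparison of the polynomial bounds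

combine-bounds : ∀ {b s t v c q} → 9 * (s ℕ.+ t) ℕ.+ 31 ℕ.≤ v →
  b * 2 ℕ.≤ 2 * c ℕ.+ q → c * 3 ℕ.+ s ℕ.≤ s * v ℕ.+ 39 * t →
  q ℕ.+ (9 * s ℕ.+ 16 * t) ≡ (3 * s ℕ.+ 4 * t) * (3 * s ℕ.+ 4 * t) →
  3 * b ℕ.+ 16 * (s ℕ.+ t) ℕ.≤ (s ℕ.+ t) * v ℕ.+ 15 * ((s ℕ.+ t) * (s ℕ.+ t))
combine-bounds {b} {s} {t} {v} {c} {q} v-large b-bound c-bound q-bound
  with w , refl ← ℕ.m≤n⇒∃[o]m+o≡n v-large
  -- Adding `16 * t` raises the coefficient of `t` from 32 to `48 = 3 * 16`, as three copies of
  -- `q-bound` require.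
  = ℕ.*-cancelˡ-≤ 2 (ℕ.+-cancelʳ-≤ (16 * t) _ _ (begin
  2 * (3 * b ℕ.+ 16 * (s ℕ.+ t)) ℕ.+ 16 * t
    ≡⟨ lhs b s t ⟩
  3 * (b * 2) ℕ.+ (32 * s ℕ.+ 48 * t)
    ≤⟨ ℕ.+-monoˡ-≤ _ (ℕ.*-monoʳ-≤ 3 b-bound) ⟩
  3 * (2 * c ℕ.+ q) ℕ.+ (32 * s ℕ.+ 48 * t)
    ≡⟨ regroup c q s t ⟩
  2 * (c * 3 ℕ.+ s) ℕ.+ 3 * (q ℕ.+ (9 * s ℕ.+ 16 * t)) ℕ.+ 3 * s
    ≤⟨ ℕ.+-mono-≤ (ℕ.+-mono-≤ (ℕ.*-monoʳ-≤ 2 c-bound) (ℕ.≤-reflexive (cong (3 *_) q-bound)))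
                  (ℕ.*-monoʳ-≤ 3 (n≤n*n s)) ⟩
  2 * (s * V ℕ.+ 39 * t) ℕ.+ 3 * ((3 * s ℕ.+ 4 * t) * (3 * s ℕ.+ 4 * t)) ℕ.+ 3 * (s * s)
    -- The added terms are the exact remaining slack. The constants 9 and 31 balance the
    -- coefficients of `t * t` and `t`: `48 = 30 + 2 * 9` and `78 = 2 * 31 + 16`.
    ≤⟨ ℕ.m≤m+n _ (6 * (s * t) ℕ.+ 2 * (t * w)) ⟩
  2 * (s * V ℕ.+ 39 * t) ℕ.+ 3 * ((3 * s ℕ.+ 4 * t) * (3 * s ℕ.+ 4 * t)) ℕ.+ 3 * (s * s)
    ℕ.+ (6 * (s * t) ℕ.+ 2 * (t * w))
    ≡⟨ rhs s t w ⟩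
  2 * ((s ℕ.+ t) * V ℕ.+ 15 * ((s ℕ.+ t) * (s ℕ.+ t))) ℕ.+ 16 * t ∎))
  where
  open ℕ.≤-Reasoning
  V : ℕ
  V = 9 * (s ℕ.+ t) ℕ.+ 31 ℕ.+ w
  n≤n*n : ∀ n → n ℕ.≤ n * n
  n≤n*n zero    = z≤n
  n≤n*n (suc n) = ℕ.m≤m*n (suc n) (suc n)
  lhs : ∀ b s t → 2 * (3 * b ℕ.+ 16 * (s ℕ.+ t)) ℕ.+ 16 * t ≡ 3 * (b * 2) ℕ.+ (32 * s ℕ.+ 48 * t)
  lhs = solve-∀
  regroup : ∀ c q s t → 3 * (2 * c ℕ.+ q) ℕ.+ (32 * s ℕ.+ 48 * t)
    ≡ 2 * (c * 3 ℕ.+ s) ℕ.+ 3 * (q ℕ.+ (9 * s ℕ.+ 16 * t)) ℕ.+ 3 * s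
  regroup = solve-∀
  rhs : ∀ s t w →
    2 * (s * (9 * (s ℕ.+ t) ℕ.+ 31 ℕ.+ w) ℕ.+ 39 * t) ℕ.+ 3 * ((3 * s ℕ.+ 4 * t) * (3 * s ℕ.+ 4 * t))
      ℕ.+ 3 * (s * s) ℕ.+ (6 * (s * t) ℕ.+ 2 * (t * w))
    ≡ 2 * ((s ℕ.+ t) * (9 * (s ℕ.+ t) ℕ.+ 31 ℕ.+ w) ℕ.+ 15 * ((s ℕ.+ t) * (s ℕ.+ t))) ℕ.+ 16 * t
  rhs = solve-∀

attained-bound : ∀ {ρ v b} → 1 ℕ.≤ ρ → 9 * ρ ℕ.+ 31 ℕ.≤ v → Attained ρ v 4 b →
                 3 * b ℕ.+ 16 * ρ ℕ.≤ ρ * v ℕ.+ 15 * (ρ * ρ)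
attained-bound {ρ} {v} {b} 1≤ρ v-large (ℬ , packing , (S , ppc , ∣S∣≡ρ) , maximal) =
  subst (λ r → 3 * b ℕ.+ 16 * r ℕ.≤ r * v ℕ.+ 15 * (r * r)) s+t≡ρ
    (combine-bounds {b} {s} {t} {c = ∑[ i < b ] coverage i} {q = Q}
      (subst (λ r → 9 * r ℕ.+ 31 ℕ.≤ v) (sym s+t≡ρ) v-large)
      (weighted-block-count 1≤ρ)
      (∑-coverage (ℕ.≤-trans (ℕ.m≤n+m 1 30) (ℕ.m+n≤o⇒n≤o (9 * ρ) v-large)))
      Q-identity)
  where open MaximumPPC packing ppc ∣S∣≡ρ maximal

-- Passage to `β` and to rational numbers

-- `greatest` returns 0 by default without testing it, so `P` may fail there and this case is kept
-- apart.
greatest-zero-or-holds : {P : ℕ → Set} (P? : Decidable P) → ∀ n →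
                         greatest P? n ≡ 0 ⊎ P (greatest P? n)
greatest-zero-or-holds P? zero = inj₁ refl
greatest-zero-or-holds P? (suc n) with P? (suc n)
... | yes P = inj₂ P
... | no _  = greatest-zero-or-holds P? n

β-bound : ∀ ρ v → 1 ℕ.≤ ρ → 9 * ρ ℕ.+ 31 ℕ.≤ v →
          3 * β ρ v 4 ℕ.+ 16 * ρ ℕ.≤ ρ * v ℕ.+ 15 * (ρ * ρ)
β-bound ρ v 1≤ρ v-large with greatest-zero-or-holds (attained? ρ v 4) (2 ^ v)
... | inj₂ attained = attained-bound 1≤ρ v-large attained
-- For the default value the bound still holds, because `v ≥ 31` already gives `16 * ρ ≤ ρ * v`.
... | inj₁ β≡0 = begin
  3 * β ρ v 4 ℕ.+ 16 * ρ      ≡⟨ cong (λ n → 3 * n ℕ.+ 16 * ρ) β≡0 ⟩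
  16 * ρ                      ≡⟨ ℕ.*-comm 16 ρ ⟩
  ρ * 16                      ≤⟨ ℕ.*-monoʳ-≤ ρ (ℕ.≤-trans (ℕ.m≤n+m 16 15) (ℕ.m+n≤o⇒n≤o (9 * ρ) v-large)) ⟩
  ρ * v                       ≤⟨ ℕ.m≤m+n _ _ ⟩
  ρ * v ℕ.+ 15 * (ρ * ρ)      ∎
  where open ℕ.≤-Reasoning

-- Unnormalised fractions keep the denominators 1 and 3, so both sums have denominator 3 and only
-- numerators need comparing. The term in `e` stands on the left to avoid subtraction.
thirds-≤ : ∀ a c d e → 3 * a ℕ.+ e ℕ.≤ c ℕ.+ 3 * d → + a / 1 + + e / 3 ≤ + c / 3 + + d / 1
thirds-≤ a c d e h = ℚ.toℚᵘ-cancel-≤ (begin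
  ℚ.toℚᵘ (+ a / 1 + + e / 3)            ≃⟨ ℚ.toℚᵘ-homo-+ (+ a / 1) (+ e / 3) ⟩
  ℚ.toℚᵘ (+ a / 1) ℚᵘ.+ ℚ.toℚᵘ (+ e / 3)
    ≃⟨ ℚᵘ.+-cong (ℚ.toℚᵘ-fromℚᵘ (mkℚᵘ (+ a) 0)) (ℚ.toℚᵘ-fromℚᵘ (mkℚᵘ (+ e) 2)) ⟩
  mkℚᵘ (+ a) 0 ℚᵘ.+ mkℚᵘ (+ e) 2        ≤⟨ *≤* cleared ⟩
  mkℚᵘ (+ c) 2 ℚᵘ.+ mkℚᵘ (+ d) 0
    ≃⟨ ℚᵘ.+-cong (ℚ.toℚᵘ-fromℚᵘ (mkℚᵘ (+ c) 2)) (ℚ.toℚᵘ-fromℚᵘ (mkℚᵘ (+ d) 0)) ⟨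
  ℚ.toℚᵘ (+ c / 3) ℚᵘ.+ ℚ.toℚᵘ (+ d / 1) ≃⟨ ℚ.toℚᵘ-homo-+ (+ c / 3) (+ d / 1) ⟨
  ℚ.toℚᵘ (+ c / 3 + + d / 1) ∎)
  where
  open ℚᵘ.≤-Reasoning
  cleared : (+ a ℤ.* + 3 ℤ.+ + e ℤ.* + 1) ℤ.* + 3 ℤ.≤ (+ c ℤ.* + 1 ℤ.+ + d ℤ.* + 3) ℤ.* + 3
  cleared = ℤ.*-monoʳ-≤-nonNeg (+ 3) (subst₂ ℤ._≤_ (sym (numerator a e)) (sym rhs) (+≤+ h))
    where
    numerator : ∀ a e → + a ℤ.* + 3 ℤ.+ + e ℤ.* + 1 ≡ + (3 * a ℕ.+ e)
    numerator a e = cong₂ ℤ._+_ (trans (sym (ℤ.pos-* a 3)) (cong +_ (ℕ.*-comm a 3))) (ℤ.*-identityʳ (+ e))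
    rhs : + c ℤ.* + 1 ℤ.+ + d ℤ.* + 3 ≡ + (c ℕ.+ 3 * d)
    rhs = trans (ℤ.+-comm (+ c ℤ.* + 1) _) (trans (numerator d c) (cong +_ (ℕ.+-comm (3 * d) c)))

theorem3p12 : ∀ (ρ v : ℕ) → 1 ℕ.≤ ρ → 9 ℕ.* ρ ℕ.+ 31 ℕ.≤ v →
    + β ρ v 4 / 1 ≤ + (ρ ℕ.* v) / 3 + + (5 ℕ.* ρ ℕ.^ 2) / 1 - + (16 ℕ.* ρ) / 3
theorem3p12 ρ v 1≤ρ v-large = begin
  -- `E` is added and subtracted so that `thirds-≤` applies to `B + E`.
  B                 ≡⟨ ℚ.+-identityʳ B ⟨
  B + 0ℚ            ≡⟨ cong (λ q → B + q) (ℚ.+-inverseʳ E) ⟨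
  B + (E - E)       ≡⟨ ℚ.+-assoc B E (ℚ.- E) ⟨
  B + E - E         ≤⟨ ℚ.+-monoˡ-≤ (ℚ.- E) (thirds-≤ (β ρ v 4) (ρ * v) (5 * ρ ^ 2) (16 * ρ) bound) ⟩
  C + D - E         ∎
  where
  open ℚ.≤-Reasoning
  B C D E : ℚ
  B = + β ρ v 4 / 1
  C = + (ρ * v) / 3
  D = + (5 * ρ ^ 2) / 1
  E = + (16 * ρ) / 3
  15ρ² : ∀ ρ → 15 * (ρ * ρ) ≡ 3 * (5 * (ρ * (ρ * 1)))
  15ρ² = solve-∀
  bound : 3 * β ρ v 4 ℕ.+ 16 * ρ ℕ.≤ ρ * v ℕ.+ 3 * (5 * ρ ^ 2)
  bound = subst (λ n → 3 * β ρ v 4 ℕ.+ 16 * ρ ℕ.≤ ρ * v ℕ.+ n) (15ρ² ρ) (β-bound ρ v 1≤ρ v-large)
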